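{- (i) For every point $\langle y\rangle\in\mathcal Y$, the point $\langle F(y)\rangle$ of $\mathrm{PG}(W)$ belongs to $\mathcal E\setminus\mathcal C$. (ii) The map $\mathcal Y\to\mathcal E\setminus\mathcal C$, $\langle y\rangle\mapsto\langle F(y)\rangle$ (the projection of $\mathcal Y$ from the line $\mathrm{PG}(V)$), is a bijection.
   Context: $q$ is a prime power. Regard $\mathbb F_{q^6}$ as a $6$-dimensional $\mathbb F_q$-vector space and let $\Pi=\mathrm{PG}(\mathbb F_{q^6})\cong\mathrm{PG}(5,q)$, whose points are $\langle x\rangle=\mathbb F_q^*x$, $x\ne0$. Let $\mathcal Y=\{\langle b-1\rangle : b\in\mathbb F_{q^6},\ b^{q^2-q+1}=1,\ b\ne 1\}$. Let $F(X)=X^{q^2}-X^q+X$, an $\mathbb F_q$-linear map of $\mathbb F_{q^6}$; let $V=\ker F$ (a $2$-dimensional $\mathbb F_q$-subspace) and $W=F(\mathbb F_{q^6})=\{z : z+z^q=z^{q^3}+z^{q^4}\}$, a $4$-dimensional $\mathbb F_q$-subspace; $\mathrm{PG}(W)\cong\mathrm{PG}(3,q)$ is identified with the quotient of $\Pi$ by $\mathrm{PG}(V)$ via $\langle x\rangle\mapsto\langle F(x)\rangle$ for $x\notin V$. Let $\Phi(z)=z^{q^2}z+z^{q^2}z^{q}+z^{q}z^{q^3}$; for $z\in W$ one has $\Phi(z)\in\mathbb F_q$, and $\mathcal E=\{\langle z\rangle\in\mathrm{PG}(W):\Phi(z)=0\}$ is a quadric of $\mathrm{PG}(W)$. Note $\mathbb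 F_{q^3}\subseteq W$; let $\mathcal C=\{\langle z\rangle\in\mathcal E: z\in\mathbb F_{q^3}\}$, the section of $\mathcal E$ by the plane $\mathrm{PG}(\mathbb F_{q^3})$ (a non-degenerate conic). -}

module Defs where

open import Algebra.Bundles using (CommutativeRing)
open import Data.Fin.Base using (Fin)
open import Data.Nat.Base as ℕ using (ℕ; suc)
open import Data.Nat.Primality using (Prime)
open import Data.Product.Base using (Σ-syntax; ∃; ∃-syntax; _×_; _,_; proj₁; proj₂)
open import Function.Bundles using (Inverse)
open import Function.Base using (_on_)
open import Level using (Level; _⊔_) renaming (suc to lsuc)
open import Relation.Binary.Bundles using (Setoid)
open import Relation.Binary.Core using (Rel)
open import Relation.Binary.PropositionalEquality.Core using (_≡_)
import Relation.Binary.PropositionalEquality.Properties as ≡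
open import Relation.Unary using (Pred; _∈_; _∉_; _∩_)

IsPrimePower : ℕ → Set
IsPrimePower q = ∃[ p ] ∃[ k ] (Prime p × q ≡ p ℕ.^ suc k)

record Field (c ℓ : Level) : Set (lsuc (c ⊔ ℓ)) where
  field
    commutativeRing : CommutativeRing c ℓ

  open CommutativeRing commutativeRing public

  field
    1≉0     : 1# ≉ 0#
    inverse : ∀ x → x ≉ 0# → ∃[ y ] (x * y ≈ 1#)

HasCardinality : ∀ {c ℓ} → Field c ℓ → ℕ → Set (c ⊔ ℓ)
HasCardinality K n = Inverse (≡.setoid (Fin n)) (Field.setoid K)

-- K is meant to be a field with q⁶ elements, q a prime power; neither
-- hypothesis is needed for the definitions.
module Geometry {c ℓ} (K : Field c ℓ) (q : ℕ) where

  open Field K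
  open import Algebra.Properties.CommutativeSemiring.Exp commutativeSemiring
    using (_^_; ^-congˡ; ^-distrib-*)
  open import Relation.Binary.Reasoning.Setoid setoid

  -- For K = 𝔽_{q⁶} and d dividing 6, the elements with x^{q^d} = x form the
  -- subfield of order q^d.
  𝔽q : Pred Carrier ℓ
  𝔽q x = x ^ q ≈ x

  𝔽q³ : Pred Carrier ℓ
  𝔽q³ x = x ^ (q ℕ.^ 3) ≈ x

  Point : Set (c ⊔ ℓ)
  Point = Σ[ x ∈ Carrier ] x ≉ 0#

  infix 4 _∼_
  _∼_ : Rel Point (c ⊔ ℓ)
  (x , _) ∼ (y , _) = ∃[ a ] (a ∈ 𝔽q × a ≉ 0# × y ≈ a * x)

  private
    1^ : ∀ n → 1# ^ n ≈ 1#
    1^ ℕ.zero  = refl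
    1^ (suc n) = trans (*-identityˡ _) (1^ n)

    ∼-refl : ∀ {p} → p ∼ p
    ∼-refl = 1# , 1^ q , 1≉0 , sym (*-identityˡ _)

    ∼-sym : ∀ {p r} → p ∼ r → r ∼ p
    ∼-sym {x , _} {y , _} (a , a^q≈a , a≉0 , y≈ax) = b , b^q≈b , b≉0 , x≈by
      where
      b = proj₁ (inverse a a≉0)
      ab≈1 : a * b ≈ 1#
      ab≈1 = proj₂ (inverse a a≉0)
      ba≈1 : b * a ≈ 1#
      ba≈1 = trans (*-comm b a) ab≈1
      b≉0 : b ≉ 0#
      b≉0 b≈0 = 1≉0 (trans (sym ab≈1) (trans (*-congˡ b≈0) (zeroʳ a)))
      b^q≈b : b ^ q ≈ b
      b^q≈b = begin
        b ^ q              ≈⟨ *-identityʳ _ ⟨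
        b ^ q * 1#         ≈⟨ *-congˡ ab≈1 ⟨
        b ^ q * (a * b)    ≈⟨ *-assoc _ _ _ ⟨
        b ^ q * a * b      ≈⟨ *-congʳ (*-congˡ a^q≈a) ⟨
        b ^ q * a ^ q * b  ≈⟨ *-congʳ (^-distrib-* b a q) ⟨
        (b * a) ^ q * b    ≈⟨ *-congʳ (^-congˡ q ba≈1) ⟩
        1# ^ q * b         ≈⟨ *-congʳ (1^ q) ⟩
        1# * b             ≈⟨ *-identityˡ b ⟩
        b                  ∎
      x≈by : x ≈ b * y
      x≈by = begin
        x            ≈⟨ *-identityˡ x ⟨
        1# * x       ≈⟨ *-congʳ ba≈1 ⟨
        b * a * x    ≈⟨ *-assoc b a x ⟩
        b * (a * x)  ≈⟨ *-congˡ y≈ax ⟨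
        b * y        ∎

    ∼-trans : ∀ {p r s} → p ∼ r → r ∼ s → p ∼ s
    ∼-trans {x , _} {y , _} {z , z≉0} (a , a^q≈a , _ , y≈ax) (b , b^q≈b , _ , z≈by) =
      b * a , trans (^-distrib-* b a q) (*-cong b^q≈b a^q≈a) , ba≉0 , z≈bax
      where
      z≈bax : z ≈ b * a * x
      z≈bax = trans z≈by (trans (*-congˡ y≈ax) (sym (*-assoc b a x)))
      ba≉0 : b * a ≉ 0#
      ba≉0 ba≈0 = z≉0 (trans z≈bax (trans (*-congʳ ba≈0) (zeroˡ x)))

  Π : Setoid (c ⊔ ℓ) (c ⊔ ℓ)
  Π = record
    { Carrier       = Point
    ; _≈_           = _∼_
    ; isEquivalence = record
      { refl  = λ {p} → ∼-refl {p}
      ; sym   = λ {p} {r} → ∼-sym {p} {r}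
      ; trans = λ {p} {r} {s} → ∼-trans {p} {r} {s}
      }
    }

  -- {⟨x⟩ : P x, x ≠ 0}, closed under ∼ by construction: P need not be.
  ⟨_⟩ : ∀ {a} → Pred Carrier a → Pred Point (c ⊔ ℓ ⊔ a)
  ⟨ P ⟩ p = ∃[ x ] Σ[ x≉0 ∈ x ≉ 0# ] (p ∼ (x , x≉0) × P x)

  -- Since q ≤ q², truncated subtraction is ordinary subtraction here.
  𝒴 : Pred Point (c ⊔ ℓ)
  𝒴 = ⟨ (λ x → ∃[ b ] (b ^ (q ℕ.^ 2 ℕ.∸ q ℕ.+ 1) ≈ 1# × b ≉ 1# × x ≈ b - 1#)) ⟩

  F : Carrier → Carrier
  F x = x ^ (q ℕ.^ 2) - x ^ q + x

  V : Pred Carrier ℓ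
  V x = F x ≈ 0#

  W : Pred Carrier (c ⊔ ℓ)
  W z = ∃[ x ] (z ≈ F x)

  Φ : Carrier → Carrier
  Φ z = z ^ (q ℕ.^ 2) * z + z ^ (q ℕ.^ 2) * z ^ q + z ^ q * z ^ (q ℕ.^ 3)

  𝓔 : Pred Point (c ⊔ ℓ)
  𝓔 = ⟨ (λ z → z ∈ W × Φ z ≈ 0#) ⟩

  𝓒 : Pred Point (c ⊔ ℓ)
  𝓒 = 𝓔 ∩ ⟨ 𝔽q³ ⟩

  -- ⟨x⟩ ↦ ⟨F(x)⟩, defined off PG(V).
  project : (p : Point) → proj₁ p ∉ V → Point
  project (x , _) x∉V = F x , x∉V

  ProjectsInto : ∀ {a b} → Pred Point a → Pred Point b → Set (c ⊔ ℓ ⊔ a ⊔ b)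
  ProjectsInto A B = ∀ p → p ∈ A → Σ[ p∉V ∈ proj₁ p ∉ V ] project p p∉V ∈ B

  projection : ∀ {a b} {A : Pred Point a} {B : Pred Point b} →
               ProjectsInto A B → ∃ A → ∃ B
  projection into (p , p∈A) = project p (proj₁ (into p p∈A)) , proj₂ (into p p∈A)

  -- Equality of points, on the elements of a point set.
  _≈ₚ_ : ∀ {a} {A : Pred Point a} → Rel (∃ A) (c ⊔ ℓ)
  _≈ₚ_ = _∼_ on proj₁

{-# OPTIONS --safe #-}

-- Write xᵢ = x^(qⁱ), so that x₆ = x on K. If b^(q²-q+1) = 1, that is b b₂ = b₁,
-- then b b₃ = 1, and z = F(1 - b) = (1 - b)(1 - b₂) satisfies z = b₁ z₃ and
-- Φ(z) = 0. Hence b₁ = z / z₃ is determined by ⟨z⟩ and is 1 exactly when z ∈ 𝔽_{q³}.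
-- Conversely, let z ∈ W with Φ(z) = 0 and put d = z - z₃ ≠ 0 and b = z₅ / z₂.
-- Membership in W says d₁ = -d, and z z₂ z₄ - z₁ z₃ z₅ = d Φ(z) = 0, whence b b₂ = b₁,
-- 1 - b = d / z₂, and F(1 - b) = d² / (z₂ z₄) is the multiple of z by d² / (z z₂ z₄) ∈ 𝔽_q.

module Submission where

open import Defs
open import Data.Fin.Base as Fin using (Fin; toℕ; fromℕ; punchIn)
open import Data.Fin.Permutation using (Permutation; permutation; _⟨$⟩ʳ_)
open import Data.Fin.Properties as Fin using (toℕ<n; toℕ-inject₁; toℕ-fromℕ; punchInᵢ≢i)
open import Data.Nat.Base as ℕ using (ℕ; zero; suc; _<_; _!; NonZero)
open import Data.Nat.Combinatorics using (_C_; nCn≡1; k![n∸k]!∣n!)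
open import Data.Nat.Combinatorics.Specification using (nCk≡n!/k![n-k]!)
open import Data.Nat.Divisibility using (_∣_; divides; m∣m*n; >⇒∤; ∣1⇒≡1)
open import Data.Nat.DivMod using (m/n*n≡m)
open import Data.Nat.GeneralisedArithmetic using (fold)
open import Data.Nat.Primality using (Prime; euclidsLemma; prime⇒nonZero; ¬prime[0]; ¬prime[1])
import Data.Nat.Properties as ℕ
open import Data.Product.Base using (Σ-syntax; _×_; _,_; proj₁; proj₂)
open import Data.Sum.Base using ([_,_]′)
open import Data.Vec.Functional using (tail; init; last; replicate; removeAt)
open import Function.Base using (_∘_; id)
open import Function.Bundles using (Inverse)
open import Function.Structures using (IsBijection)
open import Level using (_⊔_)
open import Relation.Binary.Bundles using (Setoid)
import Relation.Binary.Construct.On as On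
open import Relation.Binary.Definitions using (Decidable)
open import Relation.Binary.PropositionalEquality.Core as ≡ using (_≡_; _≢_)
open import Relation.Nullary using (¬_; yes; no; contradiction)
open import Relation.Unary using (_∈_; _∉_; _∖_)

-- The geometry needs little of the map x ↦ x^q: it is a unital ring endomorphism `φ` whose sixth
-- iterate is the identity. It is therefore carried out for an abstract `φ`. The finite field
-- supplies additivity, through characteristic p, and x^(q⁶) = x, through a product over all
-- elements. Identities are kept in additive form, with `y + b ≈ 1#` in place of y = 1 - b, so that
-- polynomial steps hold in every commutative semiring and no sign has to be carried. The source of
-- z = b₁ z₃ is that b₃ = 1/b turns y = 1 - b into y = -b y₃; two such relations multiply to the one
-- for z = y y₂, and the signs cancel. It also dictates the converse: applying φ⁵ gives z₅ = b z₂,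
-- so z₅ / z₂ is the only possible b.

-- Binomial coefficients modulo a prime.

prime∤! : ∀ {p k} → Prime p → k < p → ¬ p ∣ k !
prime∤! {k = zero}  pp _   p∣1  = ¬prime[1] (≡.subst Prime (∣1⇒≡1 p∣1) pp)
prime∤! {k = suc k} pp k<p p∣k! =
  [ >⇒∤ k<p , prime∤! pp (ℕ.<-trans (ℕ.n<1+n k) k<p) ]′ (euclidsLemma (suc k) (k !) pp p∣k!)

-- The prime p divides p! = (p C k) k! (p - k)!, but neither factorial: both k and p - k are below
-- p, the latter because k > 0.
prime∣C : ∀ {p k} → Prime p → 0 < k → k < p → p ∣ p C k
prime∣C {p@(suc n)} {k@(suc _)} pp _ k<p =
  [ id , (λ p∣d → contradiction p∣d p∤d) ]′
    (euclidsLemma (p C k) d pp (≡.subst (p ∣_) (≡.sym C*d≡p!) (m∣m*n (n !))))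
  where
  d = k ! ℕ.* (p ℕ.∸ k) !
  C*d≡p! : (p C k) ℕ.* d ≡ p !
  C*d≡p! = ≡.trans
    (≡.cong (ℕ._* d) (nCk≡n!/k![n-k]! (ℕ.<⇒≤ k<p)))
    (m/n*n≡m {{k ℕ.!* (p ℕ.∸ k) !≢0}} (k![n∸k]!∣n! (ℕ.<⇒≤ k<p)))
  p∤d : ¬ p ∣ d
  p∤d = [ prime∤! pp k<p , prime∤! pp (ℕ.∸-monoʳ-< ℕ.z<s (ℕ.<⇒≤ k<p)) ]′
        ∘ euclidsLemma (k !) ((p ℕ.∸ k) !) pp

-- Cancellation in a field, and additivity of p-th powers in characteristic p.

module FieldProperties {c ℓ} (K : Field c ℓ) where
  open Field K
  open import Relation.Binary.Reasoning.Setoid setoid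

  *-cancelˡ-≉0 : ∀ {x y z} → x ≉ 0# → x * y ≈ x * z → y ≈ z
  *-cancelˡ-≉0 {x} {y} {z} x≉0 xy≈xz = begin
    y            ≈⟨ u*x*t≈t y ⟨
    u * (x * y)  ≈⟨ *-congˡ xy≈xz ⟩
    u * (x * z)  ≈⟨ u*x*t≈t z ⟩
    z            ∎
    where
    u = proj₁ (inverse x x≉0)
    u*x*t≈t : ∀ t → u * (x * t) ≈ t
    u*x*t≈t t = begin
      u * (x * t)  ≈⟨ *-assoc u x t ⟨
      u * x * t    ≈⟨ *-congʳ (*-comm u x) ⟩
      x * u * t    ≈⟨ *-congʳ (proj₂ (inverse x x≉0)) ⟩
      1# * t       ≈⟨ *-identityˡ t ⟩
      t            ∎

  *-cancelʳ-≉0 : ∀ {x y z} → x ≉ 0# → y * x ≈ z * x → y ≈ z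
  *-cancelʳ-≉0 x≉0 yx≈zx =
    *-cancelˡ-≉0 x≉0 (trans (*-comm _ _) (trans yx≈zx (*-comm _ _)))

  *-≉0 : ∀ {x y} → x ≉ 0# → y ≉ 0# → x * y ≉ 0#
  *-≉0 x≉0 y≉0 xy≈0 = y≉0 (*-cancelˡ-≉0 x≉0 (trans xy≈0 (sym (zeroʳ _))))

  open import Algebra.Properties.Semiring.Mult semiring
    using (×-congˡ; ×-congʳ; ×-assocˡ; ×-assoc-*; ×-homo-1; ×1-homo-*)
    renaming (_×_ to _·_)
  open import Algebra.Properties.CommutativeSemiring.Exp commutativeSemiring
  open import Algebra.Properties.CommutativeSemiring.Binomial commutativeSemiring
    using (binomialTerm; theorem)
  open import Algebra.Properties.CommutativeMonoid.Sum +-commutativeMonoid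

  ·-divisible : ∀ {p m} → p · 1# ≈ 0# → ∀ x → p ∣ m → m · x ≈ 0#
  ·-divisible {p} {m} p·1≈0 x (divides k m≡kp) = begin
    m · x               ≈⟨ ×-congˡ (≡.trans m≡kp (ℕ.*-comm k p)) ⟩
    (p ℕ.* k) · x       ≈⟨ ×-assocˡ x p k ⟨
    p · (k · x)         ≈⟨ ×-congʳ p (*-identityˡ _) ⟨
    p · (1# * (k · x))  ≈⟨ ×-assoc-* p 1# (k · x) ⟨
    p · 1# * (k · x)    ≈⟨ *-congʳ p·1≈0 ⟩
    0# * (k · x)        ≈⟨ zeroˡ _ ⟩
    0#                  ∎

  ^p-homo-+ : ∀ {p} → Prime p → p · 1# ≈ 0# → ∀ x y → (x + y) ^ p ≈ x ^ p + y ^ p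
  ^p-homo-+ {zero}      pp _     x y = contradiction pp ¬prime[0]
  ^p-homo-+ {p@(suc n)} pp p·1≈0 x y = begin
    (x + y) ^ p                                  ≈⟨ theorem p x y ⟩
    term Fin.zero + sum (tail term)              ≈⟨ +-congˡ (sum-init-last (tail term)) ⟩
    term Fin.zero + (sum (init (tail term)) + last (tail term))
      ≈⟨ +-cong first≈ (+-cong middle≈ last≈) ⟩
    y ^ p + (0# + x ^ p)                         ≈⟨ +-congˡ (+-identityˡ _) ⟩
    y ^ p + x ^ p                                ≈⟨ +-comm _ _ ⟩
    x ^ p + y ^ p                                ∎
    where
    term = binomialTerm x y p
    first≈ : term Fin.zero ≈ y ^ p
    first≈ = trans (×-homo-1 _) (*-identityˡ _)
    last≈ : last (tail term) ≈ x ^ p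
    last≈ = begin
      (p C toℕ (fromℕ p)) · (x ^ toℕ (fromℕ p) * y ^ (p ℕ.∸ toℕ (fromℕ p)))
        ≡⟨ ≡.cong (λ k → (p C k) · (x ^ k * y ^ (p ℕ.∸ k))) (toℕ-fromℕ p) ⟩
      (p C p) · (x ^ p * y ^ (p ℕ.∸ p))
        ≡⟨ ≡.cong₂ (λ i j → i · (x ^ p * y ^ j)) (nCn≡1 p) (ℕ.n∸n≡0 p) ⟩
      1 · (x ^ p * 1#)  ≈⟨ trans (×-homo-1 _) (*-identityʳ _) ⟩
      x ^ p             ∎
    middle≈ : sum (init (tail term)) ≈ 0#
    middle≈ = trans
      -- Entry i of `init (tail term)` has binomial index 1 + i with i < n = p - 1, so the index
      -- lies strictly between 0 and p.
      (sum-cong-≋ λ i → ·-divisible p·1≈0 _ (prime∣C pp ℕ.z<s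
        (ℕ.s<s (≡.subst (ℕ._< n) (≡.sym (toℕ-inject₁ i)) (toℕ<n i)))))
      (sum-replicate-zero n)

  ^-iterated-homo-+ : ∀ {p} → (∀ x y → (x + y) ^ p ≈ x ^ p + y ^ p) →
                      ∀ k x y → (x + y) ^ (p ℕ.^ k) ≈ x ^ (p ℕ.^ k) + y ^ (p ℕ.^ k)
  ^-iterated-homo-+     homo zero    x y = distribʳ 1# x y
  ^-iterated-homo-+ {p} homo (suc k) x y = begin
    (x + y) ^ (p ℕ.* p ℕ.^ k)                       ≈⟨ ^-assocʳ (x + y) p (p ℕ.^ k) ⟨
    ((x + y) ^ p) ^ (p ℕ.^ k)                       ≈⟨ ^-congˡ (p ℕ.^ k) (homo x y) ⟩
    (x ^ p + y ^ p) ^ (p ℕ.^ k)                     ≈⟨ ^-iterated-homo-+ homo k (x ^ p) (y ^ p) ⟩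
    (x ^ p) ^ (p ℕ.^ k) + (y ^ p) ^ (p ℕ.^ k)       ≈⟨ +-cong (^-assocʳ x p (p ℕ.^ k)) (^-assocʳ y p (p ℕ.^ k)) ⟩
    x ^ (p ℕ.* p ℕ.^ k) + y ^ (p ℕ.* p ℕ.^ k)       ∎

  -- The map m ↦ m · 1 is multiplicative and a field has no zero divisors, so one factor p of the
  -- power can be cancelled at a time until p · 1 itself vanishes; at exponent 0 the hypothesis
  -- would read 1 = 0.
  ^·1≈0⇒·1≈0 : Decidable _≈_ → ∀ p k → (p ℕ.^ k) · 1# ≈ 0# → p · 1# ≈ 0#
  ^·1≈0⇒·1≈0 _≟_ p zero    1·1≈0 = contradiction (trans (sym (×-homo-1 1#)) 1·1≈0) 1≉0
  ^·1≈0⇒·1≈0 _≟_ p (suc k) p^k+1·1≈0 with (p · 1#) ≟ 0#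
  ... | yes p·1≈0 = p·1≈0
  ... | no  p·1≉0 = ^·1≈0⇒·1≈0 _≟_ p k (*-cancelˡ-≉0 p·1≉0
    (trans (sym (×1-homo-* p (p ℕ.^ k))) (trans p^k+1·1≈0 (sym (zeroʳ _)))))

  1#^ : ∀ n → 1# ^ n ≈ 1#
  1#^ zero    = refl
  1#^ (suc n) = trans (*-identityˡ _) (1#^ n)

-- Finite fields: the characteristic and a^n = a, by summing and multiplying over all elements.

module FiniteField {c ℓ} (K : Field c ℓ) {n} (card : HasCardinality K n) where
  open Field K
  open FieldProperties K
  open Inverse card hiding (inverse)
  open import Algebra.Properties.Semiring.Mult semiring using () renaming (_×_ to _·_)
  open import Algebra.Properties.CommutativeSemiring.Exp commutativeSemiring
  open import Algebra.Properties.AbelianGroup +-abelianGroup using (∙-cancelʳ)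
  import Algebra.Properties.CommutativeMonoid.Sum +-commutativeMonoid as ∑
  import Algebra.Properties.CommutativeMonoid.Sum *-commutativeMonoid as ∏
  open import Relation.Binary.Reasoning.Setoid setoid

  to∘from : ∀ x → to (from x) ≈ x
  to∘from x = inverseˡ ≡.refl

  _≟_ : Decidable _≈_
  x ≟ y with from x Fin.≟ from y
  ... | yes eq = yes (trans (sym (to∘from x)) (trans (to-cong eq) (to∘from y)))
  ... | no neq = no (λ x≈y → neq (from-cong x≈y))

  module _ (f g : Carrier → Carrier)
           (f-cong : ∀ {x y} → x ≈ y → f x ≈ f y) (g-cong : ∀ {x y} → x ≈ y → g x ≈ g y)
           (f∘g : ∀ x → f (g x) ≈ x) (g∘f : ∀ x → g (f x) ≈ x) where

    -- Transports a bijection of K to the index set, so that translations and dilations of K can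
    -- reindex sums and products over K.
    conjugate : Permutation n n
    conjugate = permutation (λ i → from (f (to i))) (λ i → from (g (to i)))
      (λ i → inverseʳ (trans (f-cong (to∘from _)) (f∘g _)))
      (λ i → inverseʳ (trans (g-cong (to∘from _)) (g∘f _)))

  -- Translation by 1 permutes K, so it preserves the sum of all elements while adding 1 to each of
  -- the n terms.
  order·1≈0 : n · 1# ≈ 0#
  order·1≈0 = sym (∙-cancelʳ (∑.sum to) 0# (n · 1#) (begin
    0# + ∑.sum to                        ≈⟨ +-identityˡ _ ⟩
    ∑.sum to                             ≈⟨ ∑.sum-permute to π ⟩
    ∑.sum (λ i → to (π ⟨$⟩ʳ i))          ≈⟨ ∑.sum-cong-≋ (λ i → to∘from (1# + to i)) ⟩
    ∑.sum (λ i → 1# + to i)              ≈⟨ ∑.∑-distrib-+ (λ _ → 1#) to ⟩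
    ∑.sum {n} (λ _ → 1#) + ∑.sum to      ≈⟨ +-congʳ (∑.sum-replicate n) ⟩
    n · 1# + ∑.sum to                    ∎))
    where
    π = conjugate (1# +_) (- 1# +_) +-congˡ +-congˡ
      (λ x → trans (sym (+-assoc _ _ _)) (trans (+-congʳ (-‿inverseʳ 1#)) (+-identityˡ x)))
      (λ x → trans (sym (+-assoc _ _ _)) (trans (+-congʳ (-‿inverseˡ 1#)) (+-identityˡ x)))

  prime-char : ∀ {p} k → n ≡ p ℕ.^ k → p · 1# ≈ 0#
  prime-char {p} k ≡.refl = ^·1≈0⇒·1≈0 _≟_ p k order·1≈0

  product-≉0 : ∀ {m} (t : Fin m → Carrier) → (∀ i → t i ≉ 0#) → ∏.sum t ≉ 0#
  product-≉0 {zero}  t t≉0 = 1≉0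
  product-≉0 {suc m} t t≉0 = *-≉0 (t≉0 Fin.zero) (product-≉0 (tail t) (t≉0 ∘ Fin.suc))

  -- Replacing the value at 0 by 1 turns a product over K into one over K∖{0}.
  nonzero-or-1 : (Carrier → Carrier) → Carrier → Carrier
  nonzero-or-1 f x with x ≟ 0#
  ... | yes _ = 1#
  ... | no  _ = f x

  at-0 : ∀ f {x} → x ≈ 0# → nonzero-or-1 f x ≈ 1#
  at-0 f {x} x≈0 with x ≟ 0#
  ... | yes _  = refl
  ... | no x≉0 = contradiction x≈0 x≉0

  off-0 : ∀ f {x} → x ≉ 0# → nonzero-or-1 f x ≈ f x
  off-0 f {x} x≉0 with x ≟ 0#
  ... | yes x≈0 = contradiction x≈0 x≉0
  ... | no  _   = refl

  private
    g : Carrier → Carrier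
    g = nonzero-or-1 (λ x → x)

    g-≉0 : ∀ x → g x ≉ 0#
    g-≉0 x with x ≟ 0#
    ... | yes _  = 1≉0
    ... | no x≉0 = x≉0

    g-cong : ∀ {x y} → x ≈ y → g x ≈ g y
    g-cong {x} {y} x≈y with x ≟ 0#
    ... | yes x≈0 = sym (at-0 _ (trans (sym x≈y) x≈0))
    ... | no  x≉0 = trans x≈y (sym (off-0 _ λ y≈0 → x≉0 (trans x≈y y≈0)))

    g-scale : ∀ {a} → a ≉ 0# → ∀ x → g (a * x) ≈ nonzero-or-1 (λ _ → a) x * g x
    g-scale {a} a≉0 x with x ≟ 0#
    ... | yes x≈0 = trans (at-0 _ (trans (*-congˡ x≈0) (zeroʳ a))) (sym (*-identityˡ 1#))
    ... | no  x≉0 = off-0 _ (*-≉0 a≉0 x≉0)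

    -- Dilation by a permutes K and fixes 0, so it preserves the product of the nonzero elements; it
    -- also multiplies each of them by a. Cancelling that nonzero product leaves the product of the
    -- factors a.
    ∏-scale≈1 : ∀ {a} → a ≉ 0# → ∏.sum (nonzero-or-1 (λ _ → a) ∘ to) ≈ 1#
    ∏-scale≈1 {a} a≉0 = sym (*-cancelʳ-≉0 (product-≉0 (g ∘ to) (g-≉0 ∘ to)) (begin
      1# * ∏.sum (g ∘ to)                 ≈⟨ *-identityˡ _ ⟩
      ∏.sum (g ∘ to)                      ≈⟨ ∏.sum-permute (g ∘ to) π ⟩
      ∏.sum (λ i → g (to (π ⟨$⟩ʳ i)))     ≈⟨ ∏.sum-cong-≋ (λ i → g-cong (to∘from (a * to i))) ⟩
      ∏.sum (λ i → g (a * to i))          ≈⟨ ∏.sum-cong-≋ (λ i → g-scale a≉0 (to i)) ⟩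
      ∏.sum (λ i → h (to i) * g (to i))   ≈⟨ ∏.∑-distrib-+ (h ∘ to) (g ∘ to) ⟩
      ∏.sum (h ∘ to) * ∏.sum (g ∘ to)     ∎))
      where
      h = nonzero-or-1 (λ _ → a)
      b = proj₁ (inverse a a≉0)
      ab≈1 = proj₂ (inverse a a≉0)
      π = conjugate (a *_) (b *_) *-congˡ *-congˡ
        (λ x → trans (sym (*-assoc _ _ _)) (trans (*-congʳ ab≈1) (*-identityˡ x)))
        (λ x → trans (sym (*-assoc _ _ _)) (trans (*-congʳ (trans (*-comm b a) ab≈1)) (*-identityˡ x)))

    -- One factor is 1 and the m - 1 others are a, so the product is a^(m-1). The length m is a
    -- variable here, so that it can be matched as a successor.
    fermat-≉0 : ∀ {m} (t : Fin m → Carrier) (i₀ : Fin m) a →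
                t i₀ ≈ 1# → (∀ i → i ≢ i₀ → t i ≈ a) → ∏.sum t ≈ 1# → a ^ m ≈ a
    fermat-≉0 {suc m} t i₀ a t₀≈1 t≈a ∏t≈1 = begin
      a * a ^ m                              ≈⟨ *-congˡ (∏.sum-replicate m) ⟨
      a * ∏.sum (replicate m a)              ≈⟨ *-congˡ (∏.sum-cong-≋ λ i → t≈a (punchIn i₀ i) (punchInᵢ≢i i₀ i)) ⟨
      a * ∏.sum (removeAt t i₀)              ≈⟨ *-congˡ (*-identityˡ _) ⟨
      a * (1# * ∏.sum (removeAt t i₀))       ≈⟨ *-congˡ (*-congʳ t₀≈1) ⟨
      a * (t i₀ * ∏.sum (removeAt t i₀))     ≈⟨ *-congˡ (∏.sum-remove t) ⟨
      a * ∏.sum t                            ≈⟨ *-congˡ ∏t≈1 ⟩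
      a * 1#                                 ≈⟨ *-identityʳ a ⟩
      a                                      ∎

  fermat : ∀ a → a ^ n ≈ a
  fermat a with a ≟ 0#
  -- The index `from 0#` shows that n is positive; the exponent 0 would give 0^0 = 1.
  ... | yes a≈0 = zeroPower n (from 0#)
    where
    zeroPower : ∀ m → Fin m → a ^ m ≈ a
    zeroPower (suc m) _ = trans (*-congʳ a≈0) (trans (zeroˡ _) (sym a≈0))
  ... | no  a≉0 = fermat-≉0 (nonzero-or-1 (λ _ → a) ∘ to) (from 0#) a
    (at-0 _ (to∘from 0#))
    (λ i i≢i₀ → off-0 _ λ toi≈0 → i≢i₀ (≡.sym (inverseʳ (sym toi≈0))))
    (∏-scale≈1 a≉0)

-- The algebra of the projection, for an abstract map of order dividing 6.

-- Models x ↦ x^q on 𝔽_{q⁶}.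
record SixfoldEndomorphism {c ℓ} (K : Field c ℓ) : Set (c ⊔ ℓ) where
  open Field K
  field
    φ      : Carrier → Carrier
    φ-cong : ∀ {x y} → x ≈ y → φ x ≈ φ y
    φ-+    : ∀ x y → φ (x + y) ≈ φ x + φ y
    φ-*    : ∀ x y → φ (x * y) ≈ φ x * φ y
    φ-1    : φ 1# ≈ 1#
    φ⁶≈id  : ∀ x → φ (φ (φ (φ (φ (φ x))))) ≈ x

module SixfoldEndomorphismProperties {c ℓ} {K : Field c ℓ} (σ : SixfoldEndomorphism K) where
  open Field K
  open SixfoldEndomorphism σ
  open FieldProperties K
  open import Algebra.Properties.AbelianGroup +-abelianGroup
    using (∙-cancelˡ; ∙-cancelʳ; identityˡ-unique)
  open import Algebra.Solver.Ring.NaturalCoefficients.Default commutativeSemiring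
  open import Relation.Binary.Reasoning.Setoid setoid

  φ² φ³ φ⁴ φ⁵ : Carrier → Carrier
  φ² x = φ (φ x)
  φ³ x = φ (φ² x)
  φ⁴ x = φ (φ³ x)
  φ⁵ x = φ (φ⁴ x)

  φ-0 : φ 0# ≈ 0#
  φ-0 = identityˡ-unique _ _ (trans (sym (φ-+ 0# 0#)) (φ-cong (+-identityˡ 0#)))

  φ-injective : ∀ {x y} → φ x ≈ φ y → x ≈ y
  φ-injective {x} {y} φx≈φy = begin
    x         ≈⟨ φ⁶≈id x ⟨
    φ⁵ (φ x)  ≈⟨ φ-cong (φ-cong (φ-cong (φ-cong (φ-cong φx≈φy)))) ⟩
    φ⁵ (φ y)  ≈⟨ φ⁶≈id y ⟩
    y         ∎

  φ-≉0 : ∀ {x} → x ≉ 0# → φ x ≉ 0#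
  φ-≉0 x≉0 φx≈0 = x≉0 (φ-injective (trans φx≈0 (sym φ-0)))

  φ-sum≈ : ∀ {x y z} → x + y ≈ z → φ x + φ y ≈ φ z
  φ-sum≈ e = trans (sym (φ-+ _ _)) (φ-cong e)

  φ-product≈ : ∀ {x y z} → x * y ≈ z → φ x * φ y ≈ φ z
  φ-product≈ e = trans (sym (φ-* _ _)) (φ-cong e)

  -- Makes -1 an admissible scalar, so that b - 1 and 1 - b represent the same point, whatever the
  -- parity of q.
  φ-fixes-opposite-of-1 : ∀ {x} → x + 1# ≈ 0# → φ x ≈ x
  φ-fixes-opposite-of-1 {x} x+1≈0 = ∙-cancelʳ 1# (φ x) x (begin
    φ x + 1#    ≈⟨ +-congˡ φ-1 ⟨
    φ x + φ 1#  ≈⟨ φ-sum≈ x+1≈0 ⟩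
    φ 0#        ≈⟨ φ-0 ⟩
    0#          ≈⟨ x+1≈0 ⟨
    x + 1#      ∎)

  -- z = F x without subtraction.
  IsF : Carrier → Carrier → Set ℓ
  IsF x z = z + φ x ≈ φ² x + x

  isF-unique : ∀ {x z z′} → IsF x z → IsF x z′ → z ≈ z′
  isF-unique e e′ = ∙-cancelʳ _ _ _ (trans e (sym e′))

  isF-scale : ∀ {a x z} → φ a ≈ a → IsF x z → IsF (a * x) (a * z)
  isF-scale {a} {x} {z} φa≈a e = begin
    a * z + φ (a * x)       ≈⟨ +-congˡ φ-scale ⟩
    a * z + a * φ x         ≈⟨ distribˡ _ _ _ ⟨
    a * (z + φ x)           ≈⟨ *-congˡ e ⟩
    a * (φ² x + x)          ≈⟨ distribˡ _ _ _ ⟩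
    a * φ² x + a * x        ≈⟨ +-congʳ (trans (φ-cong φ-scale) φ-scale) ⟨
    φ² (a * x) + a * x      ∎
    where
    φ-scale : ∀ {t} → φ (a * t) ≈ a * φ t
    φ-scale = trans (φ-* _ _) (*-congʳ φa≈a)

  -- With T for `φ`, this is the factorisation (1 + T)(T² - T + 1) = 1 + T³.
  isF⇒z+φz : ∀ {x z} → IsF x z → z + φ z ≈ x + φ³ x
  isF⇒z+φz {x} {z} e = ∙-cancelʳ (φ x + φ² x) _ _ (begin
    (z + φ z) + (φ x + φ² x)      ≈⟨ solve 4 (λ a b c d → (a :+ b) :+ (c :+ d) := (a :+ c) :+ (b :+ d)) refl _ _ _ _ ⟩
    (z + φ x) + (φ z + φ² x)      ≈⟨ +-cong e (trans (φ-sum≈ e) (φ-+ _ _)) ⟩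
    (φ² x + x) + (φ³ x + φ x)     ≈⟨ solve 4 (λ a b c d → (a :+ b) :+ (c :+ d) := (b :+ c) :+ (d :+ a)) refl _ _ _ _ ⟩
    (x + φ³ x) + (φ x + φ² x)     ∎)

  -- By the factorisation above, z + φ z equals x + φ³ x, which φ³ fixes because φ⁶ is the identity.
  isF⇒W : ∀ {x z} → IsF x z → z + φ z ≈ φ³ z + φ⁴ z
  isF⇒W {x} {z} e = begin
    z + φ z              ≈⟨ isF⇒z+φz e ⟩
    x + φ³ x             ≈⟨ +-comm _ _ ⟩
    φ³ x + x             ≈⟨ +-congˡ (φ⁶≈id x) ⟨
    φ³ x + φ³ (φ³ x)     ≈⟨ φ-+ _ _ ⟨
    φ (φ² x + φ² (φ³ x)) ≈⟨ φ-cong (φ-+ _ _) ⟨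
    φ² (φ x + φ (φ³ x))  ≈⟨ φ-cong (φ-cong (φ-+ _ _)) ⟨
    φ³ (x + φ³ x)        ≈⟨ φ-cong (φ-cong (φ-cong (isF⇒z+φz e))) ⟨
    φ³ (z + φ z)         ≈⟨ φ-cong (φ-cong (φ-+ _ _)) ⟩
    φ² (φ z + φ² z)      ≈⟨ φ-cong (φ-+ _ _) ⟩
    φ (φ² z + φ³ z)      ≈⟨ φ-+ _ _ ⟩
    φ³ z + φ⁴ z          ∎

  opposites-product : ∀ {x u y v} → x + u ≈ 0# → y + v ≈ 0# → u * v ≈ x * y
  opposites-product {x} {u} {y} {v} x+u≈0 y+v≈0 = ∙-cancelʳ (x * v) _ _ (begin
    u * v + x * v   ≈⟨ distribʳ v u x ⟨
    (u + x) * v     ≈⟨ *-congʳ (trans (+-comm u x) x+u≈0) ⟩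
    0# * v          ≈⟨ trans (zeroˡ v) (sym (zeroʳ x)) ⟩
    x * 0#          ≈⟨ *-congˡ y+v≈0 ⟨
    x * (y + v)     ≈⟨ distribˡ x y v ⟩
    x * y + x * v   ∎)

  -- Expansion of (1 - x)(1 - y) = 1 - z. It serves twice: with b b₂ = b₁ it turns F(y) into the
  -- product y y₂, and with b b₃ = 1, where z = 0, it gives y + y₃ = y y₃.
  complement-product : ∀ {x a y b z c} → x + a ≈ 1# → y + b ≈ 1# → z + c ≈ 1# →
                       a * b ≈ c → x + y ≈ x * y + z
  complement-product {x} {a} {y} {b} {z} {c} x+a≈1 y+b≈1 z+c≈1 ab≈c = ∙-cancelʳ c _ _ (begin
    x + y + c                              ≈⟨ +-cong (+-cong (*-identityʳ x) (*-identityʳ y)) ab≈c ⟨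
    x * 1# + y * 1# + a * b                ≈⟨ +-congʳ (+-cong (*-congˡ y+b≈1) (*-congˡ x+a≈1)) ⟨
    x * (y + b) + y * (x + a) + a * b      ≈⟨ solve 4 (λ x a y b → x :* (y :+ b) :+ y :* (x :+ a) :+ a :* b
                                                          := x :* y :+ (x :+ a) :* (y :+ b)) refl x a y b ⟩
    x * y + (x + a) * (y + b)              ≈⟨ +-congˡ (*-cong x+a≈1 y+b≈1) ⟩
    x * y + 1# * 1#                        ≈⟨ +-congˡ (*-identityˡ 1#) ⟩
    x * y + 1#                             ≈⟨ +-congˡ z+c≈1 ⟨
    x * y + (z + c)                        ≈⟨ +-assoc _ _ _ ⟨
    x * y + z + c                          ∎)

  -- The equation b^(q²-q+1) = 1 multiplied by b^q. The field `b≉0` excludes b = 0, which also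
  -- solves the multiplied equation.
  record UnitCircle (b y : Carrier) : Set ℓ where
    field
      complement : y + b ≈ 1#
      b≉0        : b ≉ 0#
      b*φ²b≈φb   : b * φ² b ≈ φ b

  Φ′ : Carrier → Carrier
  Φ′ z = φ² z * z + φ² z * φ z + φ z * φ³ z

  -- From y = 1 - b to the point F(y) of the quadric.

  module Forward {b y z : Carrier} (circle : UnitCircle b y) (y≉0 : y ≉ 0#) (z≈Fy : IsF y z) where
    open UnitCircle circle

    private
      complement₁ : φ y + φ b ≈ 1#
      complement₁ = trans (φ-sum≈ complement) φ-1
      complement₂ : φ² y + φ² b ≈ 1#
      complement₂ = trans (φ-sum≈ complement₁) φ-1
      complement₃ : φ³ y + φ³ b ≈ 1#
      complement₃ = trans (φ-sum≈ complement₂) φ-1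

    z≈y*φ²y : z ≈ y * φ² y
    z≈y*φ²y = ∙-cancelʳ (φ y) _ _ (begin
      z + φ y          ≈⟨ z≈Fy ⟩
      φ² y + y         ≈⟨ +-comm _ _ ⟩
      y + φ² y         ≈⟨ complement-product complement complement₂ complement₁ b*φ²b≈φb ⟩
      y * φ² y + φ y   ∎)

    z≉0 : z ≉ 0#
    z≉0 z≈0 = *-≉0 y≉0 (φ-≉0 (φ-≉0 y≉0)) (trans (sym z≈y*φ²y) z≈0)

    -- Applying `φ` to b b₂ = b₁ gives b₁ b₃ = b₂; multiplied by b this reads b₁ (b b₃) = b b₂ = b₁.
    b*φ³b≈1 : b * φ³ b ≈ 1#
    b*φ³b≈1 = *-cancelˡ-≉0 (φ-≉0 b≉0) (begin
      φ b * (b * φ³ b)  ≈⟨ solve 3 (λ u v w → u :* (v :* w) := v :* (u :* w)) refl _ _ _ ⟩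
      b * (φ b * φ³ b)  ≈⟨ *-congˡ (φ-product≈ b*φ²b≈φb) ⟩
      b * φ² b          ≈⟨ b*φ²b≈φb ⟩
      φ b               ≈⟨ *-identityʳ _ ⟨
      φ b * 1#          ∎)

    y+φ³y≈y*φ³y : y + φ³ y ≈ y * φ³ y
    y+φ³y≈y*φ³y =
      trans (complement-product complement complement₃ (+-identityˡ 1#) b*φ³b≈1) (+-identityʳ _)

    -- Since b₃ = 1/b, y₃ = 1 - 1/b = -y/b.
    y+b*φ³y≈0 : y + b * φ³ y ≈ 0#
    y+b*φ³y≈0 = identityˡ-unique _ (y * φ³ y) (begin
      y + b * φ³ y + y * φ³ y    ≈⟨ solve 3 (λ y b t → y :+ b :* t :+ y :* t := y :+ (y :+ b) :* t) refl y b (φ³ y) ⟩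
      y + (y + b) * φ³ y         ≈⟨ +-congˡ (trans (*-congʳ complement) (*-identityˡ _)) ⟩
      y + φ³ y                   ≈⟨ y+φ³y≈y*φ³y ⟩
      y * φ³ y                   ∎)

    φy+φb*φ⁴y≈0 : φ y + φ b * φ⁴ y ≈ 0#
    φy+φb*φ⁴y≈0 = trans (+-congˡ (sym (φ-* _ _))) (trans (φ-sum≈ y+b*φ³y≈0) φ-0)

    φ²y+φ²b*φ⁵y≈0 : φ² y + φ² b * φ⁵ y ≈ 0#
    φ²y+φ²b*φ⁵y≈0 = trans (+-congˡ (sym (φ-* _ _))) (trans (φ-sum≈ φy+φb*φ⁴y≈0) φ-0)

    φz≈φy*φ³y : φ z ≈ φ y * φ³ y
    φz≈φy*φ³y = trans (φ-cong z≈y*φ²y) (φ-* _ _)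
    φ²z≈φ²y*φ⁴y : φ² z ≈ φ² y * φ⁴ y
    φ²z≈φ²y*φ⁴y = trans (φ-cong φz≈φy*φ³y) (φ-* _ _)
    φ³z≈φ³y*φ⁵y : φ³ z ≈ φ³ y * φ⁵ y
    φ³z≈φ³y*φ⁵y = trans (φ-cong φ²z≈φ²y*φ⁴y) (φ-* _ _)

    -- Multiply y = -b y₃ by its image y₂ = -b₂ y₅: the signs cancel, b b₂ becomes b₁, and y₃ y₅ is
    -- z₃.
    z≈φb*φ³z : z ≈ φ b * φ³ z
    z≈φb*φ³z = begin
      z                             ≈⟨ z≈y*φ²y ⟩
      y * φ² y                      ≈⟨ opposites-product y+b*φ³y≈0 φ²y+φ²b*φ⁵y≈0 ⟨
      (b * φ³ y) * (φ² b * φ⁵ y)    ≈⟨ solve 4 (λ b t c u → (b :* t) :* (c :* u) := (b :* c) :* (t :* u)) refl _ _ _ _ ⟩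
      (b * φ² b) * (φ³ y * φ⁵ y)    ≈⟨ *-cong b*φ²b≈φb (sym φ³z≈φ³y*φ⁵y) ⟩
      φ b * φ³ z                    ∎

    -- The first two terms share z₂, and z + z₁ = y + y₃ = y y₃ makes their sum a product. Once z is
    -- replaced by b₁ z₃, everything has the factor y₃ z₃, and the cofactor y₁ + b₁ y₄ vanishes.
    Φ′z≈0 : Φ′ z ≈ 0#
    Φ′z≈0 = begin
      φ² z * z + φ² z * φ z + φ z * φ³ z
        ≈⟨ +-congʳ (distribˡ _ _ _) ⟨
      φ² z * (z + φ z) + φ z * φ³ z
        ≈⟨ +-cong (*-cong φ²z≈φ²y*φ⁴y (trans (isF⇒z+φz z≈Fy) y+φ³y≈y*φ³y)) (*-congʳ φz≈φy*φ³y) ⟩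
      (φ² y * φ⁴ y) * (y * φ³ y) + (φ y * φ³ y) * φ³ z
        ≈⟨ solve 6 (λ y y₁ y₂ y₃ y₄ z₃ → (y₂ :* y₄) :* (y :* y₃) :+ (y₁ :* y₃) :* z₃
                      := y₃ :* ((y :* y₂) :* y₄ :+ y₁ :* z₃)) refl _ _ _ _ _ _ ⟩
      φ³ y * ((y * φ² y) * φ⁴ y + φ y * φ³ z)
        ≈⟨ *-congˡ (+-congʳ (*-congʳ (trans (sym z≈y*φ²y) z≈φb*φ³z))) ⟩
      φ³ y * ((φ b * φ³ z) * φ⁴ y + φ y * φ³ z)
        ≈⟨ *-congˡ (solve 4 (λ b₁ z₃ y₄ y₁ → (b₁ :* z₃) :* y₄ :+ y₁ :* z₃
                      := z₃ :* (y₁ :+ b₁ :* y₄)) refl _ _ _ _) ⟩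
      φ³ y * (φ³ z * (φ y + φ b * φ⁴ y))
        ≈⟨ *-congˡ (trans (*-congˡ φy+φb*φ⁴y≈0) (zeroʳ _)) ⟩
      φ³ y * 0#
        ≈⟨ zeroʳ _ ⟩
      0# ∎

    φ³z≉z : φ³ z ≉ z
    φ³z≉z φ³z≈z = y≉0 (identityˡ-unique y 1# (trans (+-congˡ (sym b≈1)) complement))
      where
      b≈1 : b ≈ 1#
      b≈1 = φ-injective (trans
        (*-cancelʳ-≉0 z≉0 (begin
          φ b * z     ≈⟨ *-congˡ φ³z≈z ⟨
          φ b * φ³ z  ≈⟨ z≈φb*φ³z ⟨
          z           ≈⟨ *-identityˡ z ⟨
          1# * z      ∎))
        (sym φ-1))

  open Forward public using (z≉0; Φ′z≈0; φ³z≉z; z≈φb*φ³z)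

  -- Only the points ⟨z⟩ and ⟨z′⟩ are assumed equal, yet y and y′ agree exactly: scaling by a leaves
  -- the ratio z / z₃ unchanged, so no scalar is left over.
  F-scaled-injective : ∀ {b y z b′ y′ z′ a} →
    UnitCircle b y → y ≉ 0# → IsF y z → UnitCircle b′ y′ → y′ ≉ 0# → IsF y′ z′ →
    φ a ≈ a → z′ ≈ a * z → y ≈ y′
  F-scaled-injective {b} {y} {z} {b′} {y′} {z′} {a} circle y≉0 e circle′ y′≉0 e′ φa≈a z′≈az =
    ∙-cancelʳ b y y′ (begin
      y + b     ≈⟨ UnitCircle.complement circle ⟩
      1#        ≈⟨ UnitCircle.complement circle′ ⟨
      y′ + b′   ≈⟨ +-congˡ b≈b′ ⟨
      y′ + b    ∎)
    where
    φ-scale : ∀ {t t′} → t′ ≈ a * t → φ t′ ≈ a * φ t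
    φ-scale t′≈at = trans (φ-cong t′≈at) (trans (φ-* _ _) (*-congʳ φa≈a))
    b≈b′ : b ≈ b′
    b≈b′ = φ-injective (*-cancelʳ-≉0 (φ-≉0 (φ-≉0 (φ-≉0 (z≉0 circle′ y′≉0 e′)))) (begin
      φ b * φ³ z′        ≈⟨ *-congˡ (φ-scale (φ-scale (φ-scale z′≈az))) ⟩
      φ b * (a * φ³ z)   ≈⟨ solve 3 (λ u v w → u :* (v :* w) := v :* (u :* w)) refl _ _ _ ⟩
      a * (φ b * φ³ z)   ≈⟨ *-congˡ (z≈φb*φ³z circle y≉0 e) ⟨
      a * z              ≈⟨ z′≈az ⟨
      z′                 ≈⟨ z≈φb*φ³z circle′ y′≉0 e′ ⟩
      φ b′ * φ³ z′       ∎))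

  -- Reconstruction of b from a point of the quadric off the conic.

  module Backward {z : Carrier} (z≉0 : z ≉ 0#) (z∈W : z + φ z ≈ φ³ z + φ⁴ z)
                  (Φ′z≈0 : Φ′ z ≈ 0#) (φ³z≉z : φ³ z ≉ z) where

    d w : Carrier
    d = z - φ³ z
    w = proj₁ (inverse z z≉0)

    z*w≈1 : z * w ≈ 1#
    z*w≈1 = proj₂ (inverse z z≉0)

    d+φ³z≈z : d + φ³ z ≈ z
    d+φ³z≈z = trans (+-assoc _ _ _) (trans (+-congˡ (-‿inverseˡ _)) (+-identityʳ z))

    d≉0 : d ≉ 0#
    d≉0 d≈0 = φ³z≉z (trans (sym (+-identityˡ _)) (trans (+-congʳ (sym d≈0)) d+φ³z≈z))

    d+φd≈0 : d + φ d ≈ 0#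
    d+φd≈0 = identityˡ-unique _ (φ³ z + φ⁴ z) (begin
      (d + φ d) + (φ³ z + φ⁴ z)   ≈⟨ solve 4 (λ a b c d → (a :+ b) :+ (c :+ d) := (a :+ c) :+ (b :+ d)) refl _ _ _ _ ⟩
      (d + φ³ z) + (φ d + φ⁴ z)   ≈⟨ +-cong d+φ³z≈z (φ-sum≈ d+φ³z≈z) ⟩
      z + φ z                     ≈⟨ z∈W ⟩
      φ³ z + φ⁴ z                 ∎)

    φ²d≈d : φ² d ≈ d
    φ²d≈d = ∙-cancelˡ (φ d) _ _ (begin
      φ d + φ² d  ≈⟨ φ-sum≈ d+φd≈0 ⟩
      φ 0#        ≈⟨ φ-0 ⟩
      0#          ≈⟨ d+φd≈0 ⟨
      d + φ d     ≈⟨ +-comm _ _ ⟩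
      φ d + d     ∎)

    -- Because d changes sign under `φ`, z - z₃ = z₂ - z₅ = z₄ - z₁ = d. This pairs the factors of z
    -- z₂ z₄ with those of z₁ z₃ z₅ at one common difference.
    d+φ⁵z≈φ²z : d + φ⁵ z ≈ φ² z
    d+φ⁵z≈φ²z = trans (+-congʳ (sym φ²d≈d)) (φ-sum≈ (φ-sum≈ d+φ³z≈z))

    d+φz≈φ⁴z : d + φ z ≈ φ⁴ z
    d+φz≈φ⁴z = begin
      d + φ z              ≈⟨ +-congˡ (φ-sum≈ d+φ³z≈z) ⟨
      d + (φ d + φ⁴ z)     ≈⟨ +-assoc _ _ _ ⟨
      d + φ d + φ⁴ z       ≈⟨ +-congʳ d+φd≈0 ⟩
      0# + φ⁴ z            ≈⟨ +-identityˡ _ ⟩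
      φ⁴ z                 ∎

    -- The two norms differ by d Φ(z).
    norm-invariant : z * φ² z * φ⁴ z ≈ φ z * φ³ z * φ⁵ z
    norm-invariant = begin
      z * φ² z * φ⁴ z
        ≈⟨ *-cong (*-cong d+φ³z≈z d+φ⁵z≈φ²z) d+φz≈φ⁴z ⟨
      (d + φ³ z) * (d + φ⁵ z) * (d + φ z)
        ≈⟨ solve 4 (λ d z₁ z₃ z₅ → (d :+ z₃) :* (d :+ z₅) :* (d :+ z₁)
             := z₁ :* z₃ :* z₅ :+ d :* ((d :+ z₅) :* (d :+ z₃) :+ (d :+ z₅) :* z₁ :+ z₁ :* z₃))
             refl d (φ z) (φ³ z) (φ⁵ z) ⟩
      φ z * φ³ z * φ⁵ z + d * ((d + φ⁵ z) * (d + φ³ z) + (d + φ⁵ z) * φ z + φ z * φ³ z)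
        ≈⟨ +-congˡ (*-congˡ (+-congʳ (+-cong (*-cong d+φ⁵z≈φ²z d+φ³z≈z) (*-congʳ d+φ⁵z≈φ²z)))) ⟩
      φ z * φ³ z * φ⁵ z + d * Φ′ z
        ≈⟨ +-congˡ (trans (*-congˡ Φ′z≈0) (zeroʳ d)) ⟩
      φ z * φ³ z * φ⁵ z + 0#
        ≈⟨ +-identityʳ _ ⟩
      φ z * φ³ z * φ⁵ z ∎

    private
      φz*φw≈1 : φ z * φ w ≈ 1#
      φz*φw≈1 = trans (φ-product≈ z*w≈1) φ-1
      φ²z*φ²w≈1 : φ² z * φ² w ≈ 1#
      φ²z*φ²w≈1 = trans (φ-product≈ φz*φw≈1) φ-1
      φ³z*φ³w≈1 : φ³ z * φ³ w ≈ 1#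
      φ³z*φ³w≈1 = trans (φ-product≈ φ²z*φ²w≈1) φ-1
      φ⁴z*φ⁴w≈1 : φ⁴ z * φ⁴ w ≈ 1#
      φ⁴z*φ⁴w≈1 = trans (φ-product≈ φ³z*φ³w≈1) φ-1
      φ⁵z*φ⁵w≈1 : φ⁵ z * φ⁵ w ≈ 1#
      φ⁵z*φ⁵w≈1 = trans (φ-product≈ φ⁴z*φ⁴w≈1) φ-1

    factor-≉0 : ∀ {s t} → s * t ≈ 1# → t ≉ 0#
    factor-≉0 st≈1 t≈0 = 1≉0 (trans (sym st≈1) (trans (*-congˡ t≈0) (zeroʳ _)))

    -- Here `w` is 1/z, so φᵏ w inverts φᵏ z. The value of `y` is 1 - b = (z₂ - z₅) / z₂, and `a` is
    -- the quotient y y₂ / z with y₂ = d / z₄.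
    b y a : Carrier
    b = φ⁵ z * φ² w
    y = d * φ² w
    a = y * (d * φ⁴ w) * w

    y≉0 : y ≉ 0#
    y≉0 = *-≉0 d≉0 (factor-≉0 φ²z*φ²w≈1)

    a≉0 : a ≉ 0#
    a≉0 = *-≉0 (*-≉0 y≉0 (*-≉0 d≉0 (factor-≉0 φ⁴z*φ⁴w≈1))) (factor-≉0 z*w≈1)

    w-norm-invariant : w * φ² w * φ⁴ w ≈ φ w * φ³ w * φ⁵ w
    w-norm-invariant = *-cancelˡ-≉0 {z * φ² z * φ⁴ z}
      (*-≉0 (*-≉0 z≉0 (φ-≉0 (φ-≉0 z≉0))) (φ-≉0 (φ-≉0 (φ-≉0 (φ-≉0 z≉0))))) (begin
        z * φ² z * φ⁴ z * (w * φ² w * φ⁴ w)          ≈⟨ product-of-inverses z*w≈1 φ²z*φ²w≈1 φ⁴z*φ⁴w≈1 ⟩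
        1#                                           ≈⟨ product-of-inverses φz*φw≈1 φ³z*φ³w≈1 φ⁵z*φ⁵w≈1 ⟨
        φ z * φ³ z * φ⁵ z * (φ w * φ³ w * φ⁵ w)      ≈⟨ *-congʳ norm-invariant ⟨
        z * φ² z * φ⁴ z * (φ w * φ³ w * φ⁵ w)        ∎)
      where
      product-of-inverses : ∀ {s t u s′ t′ u′} → s * s′ ≈ 1# → t * t′ ≈ 1# → u * u′ ≈ 1# →
                            s * t * u * (s′ * t′ * u′) ≈ 1#
      product-of-inverses {s} {t} {u} {s′} {t′} {u′} ss′≈1 tt′≈1 uu′≈1 = begin
        s * t * u * (s′ * t′ * u′)         ≈⟨ solve 6 (λ s t u s′ t′ u′ → s :* t :* u :* (s′ :* t′ :* u′)
                                                := s :* s′ :* (t :* t′) :* (u :* u′)) refl _ _ _ _ _ _ ⟩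
        s * s′ * (t * t′) * (u * u′)       ≈⟨ *-cong (*-cong ss′≈1 tt′≈1) uu′≈1 ⟩
        1# * 1# * 1#                       ≈⟨ trans (*-identityʳ _) (*-identityʳ _) ⟩
        1#                                 ∎

    -- Up to order, `a` is d² times w w₂ w₄. Under `φ` the sign of d disappears in the square, and w
    -- w₂ w₄ becomes w₁ w₃ w₅, which has the same value.
    φa≈a : φ a ≈ a
    φa≈a = begin
      φ (y * (d * φ⁴ w) * w)
        ≈⟨ trans (φ-* _ _) (*-congʳ (trans (φ-* _ _) (*-cong (φ-* _ _) (φ-* _ _)))) ⟩
      (φ d * φ³ w) * (φ d * φ⁵ w) * φ w
        ≈⟨ rearrange (φ d) (φ w) (φ³ w) (φ⁵ w) ⟩
      (φ d * φ d) * (φ w * φ³ w * φ⁵ w)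
        ≈⟨ *-cong (opposites-product d+φd≈0 d+φd≈0) (sym w-norm-invariant) ⟩
      (d * d) * (w * φ² w * φ⁴ w)
        ≈⟨ rearrange d w (φ² w) (φ⁴ w) ⟨
      a ∎
      where
      rearrange : ∀ d s t u → (d * t) * (d * u) * s ≈ (d * d) * (s * t * u)
      rearrange = solve 4 (λ d s t u → (d :* t) :* (d :* u) :* s := (d :* d) :* (s :* t :* u)) refl

    circle : UnitCircle b y
    circle = record
      { complement = begin
          d * φ² w + φ⁵ z * φ² w   ≈⟨ distribʳ _ _ _ ⟨
          (d + φ⁵ z) * φ² w        ≈⟨ *-congʳ d+φ⁵z≈φ²z ⟩
          φ² z * φ² w              ≈⟨ φ²z*φ²w≈1 ⟩
          1#                       ∎
      ; b≉0 = *-≉0 (φ-≉0 (φ-≉0 (φ-≉0 (φ-≉0 (φ-≉0 z≉0))))) (factor-≉0 φ²z*φ²w≈1)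
      ; b*φ²b≈φb = begin
          (φ⁵ z * φ² w) * φ² (φ⁵ z * φ² w)
            ≈⟨ *-congˡ (trans (φ-cong (φ-* _ _)) (φ-* _ _)) ⟩
          (φ⁵ z * φ² w) * (φ² (φ⁵ z) * φ⁴ w)
            ≈⟨ *-congˡ (*-congʳ (φ⁶≈id (φ z))) ⟩
          (φ⁵ z * φ² w) * (φ z * φ⁴ w)
            ≈⟨ *-identityʳ _ ⟨
          (φ⁵ z * φ² w) * (φ z * φ⁴ w) * 1#
            -- The factor z₃ / z₃ completes the numerator to z₁ z₃ z₅, which may be traded for z z₂
            -- z₄; then z₂ and z₄ cancel and z / z₃ = b₁ remains.
            ≈⟨ *-congˡ φ³z*φ³w≈1 ⟨
          (φ⁵ z * φ² w) * (φ z * φ⁴ w) * (φ³ z * φ³ w)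
            ≈⟨ solve 6 (λ z₁ z₃ z₅ w₂ w₃ w₄ → (z₅ :* w₂) :* (z₁ :* w₄) :* (z₃ :* w₃)
                          := (z₁ :* z₃ :* z₅) :* (w₂ :* w₃ :* w₄)) refl _ _ _ _ _ _ ⟩
          (φ z * φ³ z * φ⁵ z) * (φ² w * φ³ w * φ⁴ w)
            ≈⟨ *-congʳ norm-invariant ⟨
          (z * φ² z * φ⁴ z) * (φ² w * φ³ w * φ⁴ w)
            ≈⟨ solve 6 (λ z z₂ z₄ w₂ w₃ w₄ → (z :* z₂ :* z₄) :* (w₂ :* w₃ :* w₄)
                          := (z :* w₃) :* ((z₂ :* w₂) :* (z₄ :* w₄))) refl _ _ _ _ _ _ ⟩
          (z * φ³ w) * ((φ² z * φ² w) * (φ⁴ z * φ⁴ w))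
            ≈⟨ *-congˡ (trans (*-cong φ²z*φ²w≈1 φ⁴z*φ⁴w≈1) (*-identityˡ 1#)) ⟩
          (z * φ³ w) * 1#
            ≈⟨ *-identityʳ _ ⟩
          z * φ³ w
            ≈⟨ *-congʳ (φ⁶≈id z) ⟨
          φ (φ⁵ z) * φ³ w
            ≈⟨ φ-* _ _ ⟨
          φ (φ⁵ z * φ² w) ∎
      }

    isF-y : ∀ {t} → IsF y t → t ≈ a * z
    isF-y {t} t≈Fy = begin
      t                         ≈⟨ Forward.z≈y*φ²y circle y≉0 t≈Fy ⟩
      y * φ² (d * φ² w)         ≈⟨ *-congˡ (trans (φ-cong (φ-* _ _)) (trans (φ-* _ _) (*-congʳ φ²d≈d))) ⟩
      y * (d * φ⁴ w)            ≈⟨ *-identityʳ _ ⟨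
      y * (d * φ⁴ w) * 1#       ≈⟨ *-congˡ (trans (*-comm w z) z*w≈1) ⟨
      y * (d * φ⁴ w) * (w * z)  ≈⟨ *-assoc _ _ _ ⟨
      a * z                     ∎

-- The Frobenius of K, and the passage from vectors to points.

module Projection {c ℓ} (q : ℕ) (pp : IsPrimePower q)
  (K : Field c ℓ) (card : HasCardinality K (q ℕ.^ 6)) where

  open Field K
  open Geometry K q
  open FieldProperties K
  open FiniteField K card using (fermat; prime-char)
  open import Algebra.Properties.AbelianGroup +-abelianGroup using (∙-cancelʳ; inverseˡ-unique)
  open import Algebra.Properties.Ring ring using (-1*x≈-x)
  open import Algebra.Properties.CommutativeSemiring.Exp commutativeSemiring
    using (_^_; ^-congˡ; ^-congʳ; ^-distrib-*; ^-homo-*; ^-assocʳ)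
  open import Relation.Binary.Reasoning.Setoid setoid

  module Π = Setoid Π

  φ : Carrier → Carrier
  φ x = x ^ q

  φ-+ : ∀ x y → φ (x + y) ≈ φ x + φ y
  φ-+ = primePower-homo-+ pp
    where
    primePower-homo-+ : IsPrimePower q → ∀ x y → φ (x + y) ≈ φ x + φ y
    primePower-homo-+ (p , k , p-prime , ≡.refl) =
      ^-iterated-homo-+ {p} (^p-homo-+ p-prime p·1≈0) (suc k)
      where p·1≈0 = prime-char {p} (suc k ℕ.* 6) (ℕ.^-*-assoc p (suc k) 6)

  q≢0 : NonZero q
  q≢0 = primePower≢0 pp
    where
    primePower≢0 : IsPrimePower q → NonZero q
    primePower≢0 (p , k , p-prime , ≡.refl) = ℕ.m^n≢0 p (suc k) {{prime⇒nonZero p-prime}}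

  ^q^k≈φᵏ : ∀ k x → x ^ (q ℕ.^ k) ≈ fold x φ k
  ^q^k≈φᵏ zero    x = *-identityʳ x
  ^q^k≈φᵏ (suc k) x = begin
    x ^ (q ℕ.* q ℕ.^ k)   ≈⟨ ^-congʳ x (ℕ.*-comm q (q ℕ.^ k)) ⟩
    x ^ (q ℕ.^ k ℕ.* q)   ≈⟨ ^-assocʳ x (q ℕ.^ k) q ⟨
    φ (x ^ (q ℕ.^ k))     ≈⟨ ^-congˡ q (^q^k≈φᵏ k x) ⟩
    φ (fold x φ k)      ∎

  frobenius : SixfoldEndomorphism K
  frobenius = record
    { φ      = φ
    ; φ-cong = ^-congˡ q
    ; φ-+    = φ-+
    ; φ-*    = λ x y → ^-distrib-* x y q
    ; φ-1    = 1#^ q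
    ; φ⁶≈id  = λ x → trans (sym (^q^k≈φᵏ 6 x)) (fermat x)
    }

  open SixfoldEndomorphismProperties frobenius

  isF-F : ∀ x → IsF x (F x)
  isF-F x = begin
    x ^ (q ℕ.^ 2) - φ x + x + φ x      ≈⟨ +-assoc _ _ _ ⟩
    x ^ (q ℕ.^ 2) - φ x + (x + φ x)    ≈⟨ +-congˡ (+-comm x (φ x)) ⟩
    x ^ (q ℕ.^ 2) - φ x + (φ x + x)    ≈⟨ +-assoc _ _ _ ⟩
    x ^ (q ℕ.^ 2) + (- φ x + (φ x + x)) ≈⟨ +-congˡ (+-assoc _ _ _) ⟨
    x ^ (q ℕ.^ 2) + (- φ x + φ x + x)  ≈⟨ +-congˡ (+-congʳ (-‿inverseˡ (φ x))) ⟩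
    x ^ (q ℕ.^ 2) + (0# + x)           ≈⟨ +-cong (^q^k≈φᵏ 2 x) (+-identityˡ x) ⟩
    φ² x + x                         ∎

  F-cong : ∀ {x y} → x ≈ y → F x ≈ F y
  F-cong x≈y = +-cong (+-cong (^-congˡ (q ℕ.^ 2) x≈y) (-‿cong (^-congˡ q x≈y))) x≈y

  F-scale : ∀ {a} x → φ a ≈ a → F (a * x) ≈ a * F x
  F-scale x φa≈a = isF-unique (isF-F _) (isF-scale φa≈a (isF-F x))

  Φ≈Φ′ : ∀ z → Φ z ≈ Φ′ z
  Φ≈Φ′ z = +-cong (+-cong (*-congʳ (^q^k≈φᵏ 2 z)) (*-congʳ (^q^k≈φᵏ 2 z))) (*-congˡ (^q^k≈φᵏ 3 z))

  ≈⇒∼ : ∀ {x y} (x≉0 : x ≉ 0#) (y≉0 : y ≉ 0#) → y ≈ x → (x , x≉0) ∼ (y , y≉0)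
  ≈⇒∼ x≉0 y≉0 y≈x = 1# , 1#^ q , 1≉0 , trans y≈x (sym (*-identityˡ _))

  project-cong : ∀ {p r} (p∉V : proj₁ p ∉ V) (r∉V : proj₁ r ∉ V) →
                 p ∼ r → project p p∉V ∼ project r r∉V
  project-cong {x , _} _ _ (a , φa≈a , a≉0 , y≈ax) =
    a , φa≈a , a≉0 , trans (F-cong y≈ax) (F-scale x φa≈a)

  q²∸q+1+q≡q²+1 : q ℕ.^ 2 ℕ.∸ q ℕ.+ 1 ℕ.+ q ≡ q ℕ.^ 2 ℕ.+ 1
  q²∸q+1+q≡q²+1 = ≡.trans (ℕ.+-assoc (q ℕ.^ 2 ℕ.∸ q) 1 q)
    (≡.trans (≡.cong (q ℕ.^ 2 ℕ.∸ q ℕ.+_) (ℕ.+-comm 1 q))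
    (≡.trans (≡.sym (ℕ.+-assoc (q ℕ.^ 2 ℕ.∸ q) q 1))
    (≡.cong (ℕ._+ 1) (ℕ.m∸n+n≡m (ℕ.m≤m*n q (q ℕ.^ 1) {{ℕ.m^n≢0 q 1 {{q≢0}}}})))))

  -- Links the truncated exponent to the equation of `UnitCircle` in both directions; the way back
  -- cancels φ b.
  ^[q²∸q+1]*φ : ∀ b → b ^ (q ℕ.^ 2 ℕ.∸ q ℕ.+ 1) * φ b ≈ b * φ² b
  ^[q²∸q+1]*φ b = begin
    b ^ (q ℕ.^ 2 ℕ.∸ q ℕ.+ 1) * φ b    ≈⟨ ^-homo-* b (q ℕ.^ 2 ℕ.∸ q ℕ.+ 1) q ⟨
    b ^ (q ℕ.^ 2 ℕ.∸ q ℕ.+ 1 ℕ.+ q)    ≈⟨ ^-congʳ b q²∸q+1+q≡q²+1 ⟩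
    b ^ (q ℕ.^ 2 ℕ.+ 1)                ≈⟨ ^-homo-* b (q ℕ.^ 2) 1 ⟩
    b ^ (q ℕ.^ 2) * (b * 1#)           ≈⟨ *-cong (^q^k≈φᵏ 2 b) (*-identityʳ b) ⟩
    φ² b * b                         ≈⟨ *-comm _ _ ⟩
    b * φ² b                         ∎

  ^[m+1]≈1⇒≉0 : ∀ {b} m → b ^ (m ℕ.+ 1) ≈ 1# → b ≉ 0#
  ^[m+1]≈1⇒≉0 {b} m b^m+1≈1 b≈0 = 1≉0 (begin
    1#                    ≈⟨ b^m+1≈1 ⟨
    b ^ (m ℕ.+ 1)         ≈⟨ ^-congʳ b (ℕ.+-comm m 1) ⟩
    b * b ^ m             ≈⟨ *-congʳ b≈0 ⟩
    0# * b ^ m            ≈⟨ zeroˡ _ ⟩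
    0#                    ∎)

  -- ⟨1 − b⟩ = ⟨b − 1⟩, and F(1 − b) = (1 − b)(1 − b)^(q²) carries no sign.
  record CirclePoint (p : Point) : Set (c ⊔ ℓ) where
    field
      b y    : Carrier
      y≉0    : y ≉ 0#
      circle : UnitCircle b y
      p∼y    : p ∼ (y , y≉0)

  -1≉0 : - 1# ≉ 0#
  -1≉0 -1≈0 = 1≉0 (trans (sym (+-identityˡ 1#)) (trans (+-congʳ (sym -1≈0)) (-‿inverseˡ 1#)))

  -‿∼ : ∀ {x y} (x≉0 : x ≉ 0#) (y≉0 : y ≉ 0#) → y ≈ - x → (x , x≉0) ∼ (y , y≉0)
  -‿∼ {x} _ _ y≈-x =
    - 1# , φ-fixes-opposite-of-1 (-‿inverseˡ 1#) , -1≉0 , trans y≈-x (sym (-1*x≈-x x))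

  x-y+y≈x : ∀ x y → x - y + y ≈ x
  x-y+y≈x x y = trans (+-assoc _ _ _) (trans (+-congˡ (-‿inverseˡ y)) (+-identityʳ x))

  opposite-differences : ∀ x y → (x - y) + (y - x) ≈ 0#
  opposite-differences x y = begin
    (x - y) + (y - x)    ≈⟨ +-assoc _ _ _ ⟨
    (x - y) + y - x      ≈⟨ +-congʳ (x-y+y≈x x y) ⟩
    x - x                ≈⟨ -‿inverseʳ x ⟩
    0#                   ∎

  𝒴⇒circle : ∀ {p} → p ∈ 𝒴 → CirclePoint p
  𝒴⇒circle {p} (x , x≉0 , p∼x , b , b^≈1 , b≉1 , x≈b-1) = record
    { b = b
    ; y = 1# - b
    ; y≉0 = y≉0
    ; circle = record
      { complement = x-y+y≈x 1# b
      ; b≉0        = ^[m+1]≈1⇒≉0 (q ℕ.^ 2 ℕ.∸ q) b^≈1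
      ; b*φ²b≈φb   = trans (sym (^[q²∸q+1]*φ b)) (trans (*-congʳ b^≈1) (*-identityˡ (φ b)))
      }
    ; p∼y = Π.trans {p} {x , x≉0} {1# - b , y≉0} p∼x
        (-‿∼ x≉0 y≉0 (trans (inverseˡ-unique _ _ (opposite-differences 1# b)) (-‿cong (sym x≈b-1))))
    }
    where
    y≉0 : 1# - b ≉ 0#
    y≉0 y≈0 = b≉1 (trans (sym (+-identityˡ b)) (trans (+-congʳ (sym y≈0)) (x-y+y≈x 1# b)))

  circle⇒𝒴 : ∀ {p} → CirclePoint p → p ∈ 𝒴
  circle⇒𝒴 {p} P = b - 1# , b-1≉0 , Π.trans {p} {y , y≉0} {b - 1# , b-1≉0} p∼y
      (-‿∼ y≉0 b-1≉0 (inverseˡ-unique _ _ (trans (+-congˡ y≈1-b) (opposite-differences b 1#))))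
    , b , b^≈1 , b≉1 , refl
    where
    open CirclePoint P
    open UnitCircle circle
    y≈1-b : y ≈ 1# - b
    y≈1-b = ∙-cancelʳ b _ _ (trans complement (sym (x-y+y≈x 1# b)))
    b≉1 : b ≉ 1#
    b≉1 b≈1 = y≉0 (trans y≈1-b (trans (+-congˡ (-‿cong b≈1)) (-‿inverseʳ 1#)))
    b-1≉0 : b - 1# ≉ 0#
    b-1≉0 b-1≈0 = b≉1 (trans (sym (x-y+y≈x b 1#)) (trans (+-congʳ b-1≈0) (+-identityˡ 1#)))
    b^≈1 : b ^ (q ℕ.^ 2 ℕ.∸ q ℕ.+ 1) ≈ 1#
    b^≈1 = *-cancelʳ-≉0 (φ-≉0 b≉0) (trans (^[q²∸q+1]*φ b) (trans b*φ²b≈φb (sym (*-identityˡ (φ b)))))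

  module Image {p} (P : CirclePoint p) where
    open CirclePoint P public

    Fy≉0 : F y ≉ 0#
    Fy≉0 = z≉0 circle y≉0 (isF-F y)

    p∉V : proj₁ p ∉ V
    p∉V Fx≈0 = let (a , φa≈a , _ , y≈ax) = p∼y in
      Fy≉0 (trans (F-cong y≈ax) (trans (F-scale _ φa≈a) (trans (*-congˡ Fx≈0) (zeroʳ a))))

    image : Point
    image = F y , Fy≉0

    project∼image : ∀ (x∉V : proj₁ p ∉ V) → project p x∉V ∼ image
    project∼image x∉V = project-cong {p} {y , y≉0} x∉V Fy≉0 p∼y

  project∈𝓔 : ∀ {p} (P : CirclePoint p) → project p (Image.p∉V P) ∈ 𝓔
  project∈𝓔 P = F y , Fy≉0 , project∼image p∉V
    , (y , refl) , trans (Φ≈Φ′ (F y)) (Φ′z≈0 circle y≉0 (isF-F y))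
    where open Image P

  -- Membership in the conic only provides some representative in 𝔽_{q³}; scalars fixed by `φ` carry
  -- the property over to F(y).
  φ³-fixed-scale : ∀ {a z x} → φ a ≈ a → a ≉ 0# → x ≈ a * z → φ³ x ≈ x → φ³ z ≈ z
  φ³-fixed-scale {a} {z} {x} φa≈a a≉0 x≈az φ³x≈x = *-cancelˡ-≉0 a≉0 (begin
    a * φ³ z   ≈⟨ φ-scale (φ-scale (φ-scale x≈az)) ⟨
    φ³ x       ≈⟨ φ³x≈x ⟩
    x          ≈⟨ x≈az ⟩
    a * z      ∎)
    where
    φ-scale : ∀ {t t′} → t′ ≈ a * t → φ t′ ≈ a * φ t
    φ-scale t′≈at = trans (^-congˡ q t′≈at) (trans (^-distrib-* _ _ q) (*-congʳ φa≈a))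

  project∉𝓒 : ∀ {p} (P : CirclePoint p) → project p (Image.p∉V P) ∉ 𝓒
  project∉𝓒 {p} P (_ , x , x≉0 , r∼x , x∈𝔽q³) =
    φ³z≉z circle y≉0 (isF-F y)
      (φ³-fixed-scale φa≈a a≉0 x≈aFy (trans (sym (^q^k≈φᵏ 3 x)) x∈𝔽q³))
    where
    open Image P
    r = project p p∉V
    image∼x : image ∼ (x , x≉0)
    image∼x = Π.trans {image} {r} {x , x≉0} (Π.sym {r} {image} (project∼image p∉V)) r∼x
    φa≈a = proj₁ (proj₂ image∼x)
    a≉0 = proj₁ (proj₂ (proj₂ image∼x))
    x≈aFy = proj₂ (proj₂ (proj₂ image∼x))

  into : ProjectsInto 𝒴 (𝓔 ∖ 𝓒)
  into p p∈𝒴 = Image.p∉V P , project∈𝓔 P , project∉𝓒 P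
    where P = 𝒴⇒circle {p} p∈𝒴

  project-injective : ∀ {p r} (P : CirclePoint p) (R : CirclePoint r) →
                      project p (Image.p∉V P) ∼ project r (Image.p∉V R) → p ∼ r
  project-injective {p} {r} P R p′∼r′ =
    Π.trans {p} {P.y , P.y≉0} {r} P.p∼y
      (Π.trans {P.y , P.y≉0} {R.y , R.y≉0} {r} (≈⇒∼ P.y≉0 R.y≉0 (sym y≈y′))
        (Π.sym {r} {R.y , R.y≉0} R.p∼y))
    where
    module P = Image P
    module R = Image R
    p′ = project p P.p∉V
    r′ = project r R.p∉V
    images : P.image ∼ R.image
    images = Π.trans {P.image} {p′} {R.image} (Π.sym {p′} {P.image} (P.project∼image P.p∉V))
      (Π.trans {p′} {r′} {R.image} p′∼r′ (R.project∼image R.p∉V))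
    y≈y′ : P.y ≈ R.y
    y≈y′ = F-scaled-injective P.circle P.y≉0 (isF-F P.y) R.circle R.y≉0 (isF-F R.y)
      (proj₁ (proj₂ images)) (proj₂ (proj₂ (proj₂ images)))

  W⇒ : ∀ {z} → z ∈ W → z + φ z ≈ φ³ z + φ⁴ z
  W⇒ (x , z≈Fx) = isF⇒W (trans (+-congʳ z≈Fx) (isF-F x))

  preimage : ∀ {p} → p ∈ 𝓔 ∖ 𝓒 →
             Σ[ r ∈ Point ] Σ[ R ∈ CirclePoint r ] Image.image R ∼ p
  preimage {p} (p∈𝓔@(z , z≉0 , p∼z , z∈W , Φz≈0) , p∉𝓒) =
    (y , y≉0) , R , Π.sym {p} {Image.image R}
      (Π.trans {p} {z , z≉0} {Image.image R} p∼z (a , φa≈a , a≉0 , isF-y (isF-F y)))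
    where
    open Backward z≉0 (W⇒ z∈W) (trans (sym (Φ≈Φ′ z)) Φz≈0)
      -- If φ³ fixed z, then z itself would be a representative in 𝔽_{q³} placing p on the conic.
      (λ φ³z≈z → p∉𝓒 (p∈𝓔 , z , z≉0 , p∼z , trans (^q^k≈φᵏ 3 z) φ³z≈z))
    R : CirclePoint (y , y≉0)
    R = record { b = b ; y = y ; y≉0 = y≉0 ; circle = circle ; p∼y = Π.refl {y , y≉0} }

  isBijection : IsBijection (_≈ₚ_ {A = 𝒴}) (_≈ₚ_ {A = 𝓔 ∖ 𝓒}) (projection into)
  isBijection = record
    { isInjection = record
      { isCongruent = record
        { cong           = λ {(p , p∈𝒴)} {(r , r∈𝒴)} →
            project-cong {p} {r} (proj₁ (into p p∈𝒴)) (proj₁ (into r r∈𝒴))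
        ; isEquivalence₁ = On.isEquivalence proj₁ Π.isEquivalence
        ; isEquivalence₂ = On.isEquivalence proj₁ Π.isEquivalence
        }
      ; injective = λ {(p , p∈𝒴)} {(r , r∈𝒴)} →
          project-injective {p} {r} (𝒴⇒circle {p} p∈𝒴) (𝒴⇒circle {r} r∈𝒴)
      }
    ; surjective = λ (p , p∈𝓔∖𝓒) → let (r , R , image∼p) = preimage {p} p∈𝓔∖𝓒 in
        -- `surjective` demands that every s equivalent to r be sent to p, so the image of s is
        -- first compared with that of r.
        (r , circle⇒𝒴 R) , λ {(s , s∈𝒴)} s∼r →
          let s∉V = proj₁ (into s s∈𝒴)
              s′  = project s s∉V
              r′  = project r (Image.p∉V R)
          in Π.trans {s′} {r′} {p} (project-cong {s} {r} s∉V (Image.p∉V R) s∼r)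
               (Π.trans {r′} {Image.image R} {p} (Image.project∼image R (Image.p∉V R)) image∼p)
    }

open import Data.Nat.Base using (_^_)

mainTheorem15 : ∀ {c ℓ} (q : ℕ) → IsPrimePower q →
    (K : Field c ℓ) → HasCardinality K (q ^ 6) →
    let open Geometry K q in
    Σ[ into ∈ ProjectsInto 𝒴 (𝓔 ∖ 𝓒) ]
    IsBijection (_≈ₚ_ {A = 𝒴}) (_≈ₚ_ {A = 𝓔 ∖ 𝓒}) (projection into)
mainTheorem15 q pp K card = Projection.into q pp K card , Projection.isBijection q pp K card
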